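{- For every integer $n>1$, $l(n)\leq 0.75\,n^2$. Equivalently in spirit: every generalized Latin square of order $n>1$ containing at least $l(n)$ symbols, where $l(n)\le 0.75n^2$, has a transversal.
   Context: A generalized Latin square of order $n$ is an $n\times n$ matrix whose entries are symbols, such that each symbol appears at most once in each row and at most once in each column. A diagonal is a set of $n$ entries containing exactly one entry from each row and exactly one from each column; a transversal is a diagonal whose $n$ entries are pairwise distinct symbols. $l(n)$ denotes the least integer such that every generalized Latin square of order $n$ containing at least $l(n)$ distinct symbols has a transversal. (Equivalently, $l(n)$ is the least number of colors such that every proper edge-coloring of $K_{n,n}$ with at least $l(n)$ colors has a perfect matching whose edges have pairwise distinct colors.) -}

module Defs where

open import Data.Nat using (ℕ)
open import Data.Fin using (Fin)
open import Data.Product using (_×_; Σ; _,_)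
open import Relation.Binary.PropositionalEquality using (_≡_)
open import Function.Definitions using (Injective)

Square : ℕ → Set
Square n = Fin n → Fin n → ℕ

IsGenLatin : (n : ℕ) → Square n → Set
IsGenLatin n L =
  (∀ i j j′ → L i j ≡ L i j′ → j ≡ j′) ×
  (∀ i i′ j → L i j ≡ L i′ j → i ≡ i′)

HasAtLeastSymbols : (n : ℕ) → Square n → ℕ → Set
HasAtLeastSymbols n L k =
  Σ (Fin k → Fin n × Fin n) λ c →
    ∀ a b → (let (i , j) = c a ; (i′ , j′) = c b in L i j ≡ L i′ j′) → a ≡ b

HasTransversal : (n : ℕ) → Square n → Set
HasTransversal n L =
  Σ (Fin n → Fin n) λ σ →
    Injective _≡_ _≡_ σ × (∀ i i′ → L i (σ i) ≡ L i′ (σ i′) → i ≡ i′)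

{-# OPTIONS --safe #-}

-- Call a cell single if its symbol occurs nowhere else. By induction on n,
-- either deleting the row and the column of some single cell leaves enough
-- symbols, and that cell extends a transversal of the minor; or every deletion
-- loses many symbols, which forces more than n/2 single cells in every row and
-- every column that contains one.
--
-- In the second case, let P be the rows and Q the columns without single cells.
-- Having 3n²/4 symbols bounds |P| and |Q| so that a partial transversal covering
-- P and Q can be chosen greedily, provided about |P|/2 of its cells lie in P × Q.
-- An uncovered row x and an uncovered column y then have more than n single
-- cells together, so either one of these extends the partial transversal, or
-- some chosen cell (r , c) can be traded for the single cells (x , c) and (r , y).
-- Rows and columns once covered stay covered.
module Submission where

open import Defs
open import Data.Fin using (Fin; punchIn; punchOut; splitAt; suc; zero)
open import Data.Fin.Properties using (*↔×; +↔⊎; _≟_; all?; any?; injective⇒≤; punchIn-injective; punchIn-punchOut; punchInᵢ≢i; punchOut-injective; suc-injective)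
open import Data.Nat using (_*_; _+_; _<_; _≤_; suc; s≤s; zero; z≤n; ℕ; ⌈_/2⌉; ⌊_/2⌋)
open import Data.Nat.Divisibility using (n∣m*n)
open import Data.Nat.DivMod using (_/_; _%_; +-distrib-/-∣ʳ; m%n<n; m*n/n≡m; m<n⇒m/n≡0; m≡m%n+[m/n]*n)
open import Data.Nat.Properties using (*-cancelˡ-≤; *-mono-≤; *-monoʳ-≤; +-cancelʳ-≤; +-cancelˡ-≤; +-identityʳ; +-mono-≤; +-monoʳ-≤; +-monoˡ-≤; +-suc; <-≤-trans; <⇒≱; _≤?_; m+1+n≰m; module ≤-Reasoning; m≤m+n; m≤n⇒m≤1+n; m≤n⇒∃[o]m+o≡n; n≤1+n; ≤-<-trans; ≤-pred; ≤-refl; ≤-reflexive; ≤-total; ≤-trans; ≰⇒>; ⌊n/2⌋+⌈n/2⌉≡n; ⌊n/2⌋≤⌈n/2⌉) renaming (_≟_ to _≟ℕ_)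
open import Data.Nat.Tactic.RingSolver using (solve-∀)
open import Data.Product using (_,_; _×_; proj₁; proj₂; Σ; ∃; ∃₂) renaming (swap to swap×)
open import Data.Product.Properties using (,-injective)
open import Data.Sum using ([_,_]′; _⊎_; inj₁; inj₂) renaming (map to map⊎; swap to swap⊎)
open import Data.Sum.Function.Propositional using (_⊎-↔_)
open import Data.Sum.Properties using (inj₁-injective; inj₂-injective)
open import Function using (_∘_; id)
open import Function.Bundles using (Injection; Inverse; _↔_)
open import Function.Construct.Identity using (↔-id)
open import Function.Definitions using (Injective)
open import Function.Properties.Inverse using (↔-sym; ↔-trans; ↔⇒↣)
open import Relation.Binary.PropositionalEquality using (_≡_; _≢_; cong; cong₂; refl; subst; subst₂; sym; trans)
open import Relation.Nullary using (Dec; contradiction; no; yes; ¬_)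
open import Relation.Nullary.Decidable using (_×-dec_; decidable-stable; ¬?)
open import Relation.Unary using (Decidable)

-- Counting in finite sets: injections, pigeonhole, enumerations.

Inj : {A B : Set} → (A → B) → Set
Inj f = ∀ a b → f a ≡ f b → a ≡ b

card-≤ : ∀ {a b} {X Y : Set} → Fin a ↔ X → Fin b ↔ Y → (f : X → Y) → Inj f → a ≤ b
card-≤ A B f inj =
  injective⇒≤ {f = Injection.to (↔⇒↣ (↔-sym B)) ∘ f ∘ Injection.to (↔⇒↣ A)}
    (λ e → Injection.injective (↔⇒↣ A)
             (inj _ _ (Injection.injective (↔⇒↣ (↔-sym B)) e)))

disjoint-≤ : ∀ {a b m} (f : Fin a → Fin m) (g : Fin b → Fin m) → Inj f → Inj g →
             (∀ x y → f x ≢ g y) → a + b ≤ m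
disjoint-≤ {a} {b} {m} f g fi gi dis = card-≤ +↔⊎ (↔-id (Fin m)) h h-inj
  where
  h : Fin a ⊎ Fin b → Fin m
  h = [ f , g ]′
  h-inj : Inj h
  h-inj (inj₁ x) (inj₁ y) e = cong inj₁ (fi x y e)
  h-inj (inj₁ x) (inj₂ y) e = contradiction e (dis x y)
  h-inj (inj₂ x) (inj₁ y) e = contradiction (sym e) (dis y x)
  h-inj (inj₂ x) (inj₂ y) e = cong inj₂ (gi x y e)

-- If every `a` had a bad `b`, choosing one for each would inject `Fin y` into `Fin z`, since no `b`
-- is bad for two different `a`.
pick : ∀ {y z} (Bad : Fin y → Fin z → Set) → (∀ a b → Dec (Bad a b)) →
       (∀ a a′ b → Bad a b → Bad a′ b → a ≡ a′) → z < y →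
       ∃ λ a → ∀ b → ¬ Bad a b
pick {y} {z} Bad bad? uniq z<y with any? (λ a → all? (λ b → ¬? (bad? a b)))
... | yes p = p
... | no ¬p = contradiction z<y (λ lt → <⇒≱ lt (injective⇒≤ {f = proj₁ ∘ hit} inj))
  where
  hit : ∀ a → ∃ λ b → Bad a b
  hit a with any? (bad? a)
  ... | yes h = h
  ... | no ¬h = contradiction (a , λ b h → ¬h (b , h)) ¬p
  inj : Injective _≡_ _≡_ (proj₁ ∘ hit)
  inj {a} {a′} e = uniq a a′ _ (proj₂ (hit a)) (subst (Bad a′) (sym e) (proj₂ (hit a′)))

record AtLeast {k} (c : ℕ) (P : Fin k → Set) : Set where
  constructor atLeast
  field
    at    : Fin c → Fin k
    inj   : Inj at
    holds : ∀ a → P (at a)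

none : ∀ {k} {P : Fin k → Set} → AtLeast 0 P
none = atLeast (λ ()) (λ ()) (λ ())

atLeast-suc : ∀ {k c} {P : Fin (suc k) → Set} → AtLeast c (P ∘ suc) → AtLeast c P
atLeast-suc (atLeast f inj h) = atLeast (suc ∘ f) (λ a b e → inj a b (suc-injective e)) h

atLeast-zero : ∀ {k c} {P : Fin (suc k) → Set} → P zero → AtLeast c (P ∘ suc) → AtLeast (suc c) P
atLeast-zero {P = P} p (atLeast f inj h) = atLeast f′ inj′ h′
  where
  f′ : Fin _ → Fin _
  f′ zero = zero
  f′ (suc a) = suc (f a)
  inj′ : Inj f′
  inj′ zero zero _ = refl
  inj′ zero (suc _) ()
  inj′ (suc _) zero ()
  inj′ (suc a) (suc b) e = cong suc (inj a b (suc-injective e))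
  h′ : ∀ a → P (f′ a)
  h′ zero = p
  h′ (suc a) = h a

-- Fewer than `x` indices in `P` and fewer than `y` in `Q` would make at most `x + y - 2 < k` in
-- all.
split : ∀ {k} x y {P Q : Fin k → Set} → (∀ a → P a ⊎ Q a) → x + y ≤ suc k →
        AtLeast x P ⊎ AtLeast y Q
split zero y d le = inj₁ none
split (suc x) zero d le = inj₂ none
split {zero} (suc x) (suc y) d (s≤s le) with x | le
... | zero | ()
... | suc _ | ()
split {suc k} (suc x) (suc y) d (s≤s le) with d zero
... | inj₁ p with split x (suc y) (d ∘ suc) le
...   | inj₁ r = inj₁ (atLeast-zero p r)
...   | inj₂ r = inj₂ (atLeast-suc r)
split {suc k} (suc x) (suc y) d (s≤s le) | inj₂ q with split (suc x) y (d ∘ suc) (subst (_≤ suc k) (+-suc x y) le)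
...   | inj₁ r = inj₁ (atLeast-suc r)
...   | inj₂ r = inj₂ (atLeast-zero q r)

record Enum {n} (P : Fin n → Set) (c : ℕ) : Set where
  field
    el       : Fin c → Fin n
    inj      : Inj el
    sound    : ∀ a → P (el a)
    complete : ∀ i → P i → ∃ λ a → el a ≡ i

  index : ∀ i → P i → Fin c
  index i p = proj₁ (complete i p)

  el-index : ∀ i p → el (index i p) ≡ i
  el-index i p = proj₂ (complete i p)

  index-injective : ∀ {i j p q} → index i p ≡ index j q → i ≡ j
  index-injective {i} {j} {p} {q} e = trans (sym (el-index i p)) (trans (cong el e) (el-index j q))

enumerate : ∀ {n} {P : Fin n → Set} → Decidable P → ∃ (Enum P)
enumerate {zero} P? = 0 , record { el = λ () ; inj = λ () ; sound = λ () ; complete = λ () }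
enumerate {suc n} {P} P? with enumerate (P? ∘ suc) | P? zero
... | c , E | yes p = suc c , record { el = AtLeast.at al ; inj = AtLeast.inj al ; sound = AtLeast.holds al ; complete = compl }
  where
  open Enum E
  al : AtLeast (suc c) P
  al = atLeast-zero p (atLeast el inj sound)
  compl : ∀ i → P i → ∃ λ a → AtLeast.at al a ≡ i
  compl zero _ = zero , refl
  compl (suc i) q = suc (index i q) , cong suc (el-index i q)
... | c , E | no ¬p = c , record { el = suc ∘ el ; inj = λ a b e → inj a b (suc-injective e) ; sound = sound ; complete = compl }
  where
  open Enum E
  compl : ∀ i → P i → ∃ λ a → suc (el a) ≡ i
  compl zero p = contradiction p ¬p
  compl (suc i) q = index i q , cong suc (el-index i q)

choice : ∀ {n} {A : Set} {B : Fin n → Set} → (∀ i → A ⊎ B i) → A ⊎ (∀ i → B i)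
choice {zero} f = inj₂ λ ()
choice {suc n} f with f zero | choice (f ∘ suc)
... | inj₁ a | _ = inj₁ a
... | inj₂ _ | inj₁ a = inj₁ a
... | inj₂ b | inj₂ g = inj₂ λ { zero → b ; (suc i) → g i }

double-< : ∀ {t x n} → t < x → x + x ≤ suc n → t + t < n
double-< {t} lt le = ≤-pred (≤-trans (≤-reflexive (cong suc (sym (+-suc t t)))) (≤-trans (+-mono-≤ lt lt) le))

-- Partial transversals and greedy covering.

transpose : ∀ {n} → Square n → Square n
transpose L i j = L j i

transpose-latin : ∀ {n} {L : Square n} → IsGenLatin n L → IsGenLatin n (transpose L)
transpose-latin (rows , cols) = (λ i j j′ → cols j j′ i) , (λ i i′ j → rows j i i′)

record Partial {n} (L : Square n) (t : ℕ) : Set where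
  field
    row     : Fin t → Fin n
    col     : Fin t → Fin n
    row-inj : Inj row
    col-inj : Inj col
    sym-inj : Inj (λ a → L (row a) (col a))

RowCov ColCov : ∀ {n t} {L : Square n} → Partial L t → Fin n → Set
RowCov T i = ∃ λ b → Partial.row T b ≡ i
ColCov T j = ∃ λ b → Partial.col T b ≡ j

rowCov? : ∀ {n t} {L : Square n} (T : Partial L t) → Decidable (RowCov T)
rowCov? T i = any? (λ b → Partial.row T b ≟ i)

colCov? : ∀ {n t} {L : Square n} (T : Partial L t) → Decidable (ColCov T)
colCov? T j = any? (λ b → Partial.col T b ≟ j)

infix 4 _⊑_
-- Only covered rows and columns are compared, not cells, because the exchange in `augment` replaces
-- a cell.
_⊑_ : ∀ {n t t′} {L : Square n} → Partial L t → Partial L t′ → Set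
T ⊑ T′ = (∀ i → RowCov T i → RowCov T′ i) × (∀ j → ColCov T j → ColCov T′ j)

⊑-refl : ∀ {n t} {L : Square n} {T : Partial L t} → T ⊑ T
⊑-refl = (λ _ c → c) , (λ _ c → c)

⊑-trans : ∀ {n t t′ t″} {L : Square n} {T : Partial L t} {T′ : Partial L t′} {T″ : Partial L t″} →
          T ⊑ T′ → T′ ⊑ T″ → T ⊑ T″
⊑-trans (r , c) (r′ , c′) = (λ i → r′ i ∘ r i) , (λ j → c′ j ∘ c j)

transposeᵖ : ∀ {n t} {L : Square n} → Partial L t → Partial (transpose L) t
transposeᵖ T = record { row = col ; col = row ; row-inj = col-inj ; col-inj = row-inj ; sym-inj = sym-inj }
  where open Partial T

module _ {n} {L : Square n} where

  empty : Partial L 0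
  empty = record { row = λ () ; col = λ () ; row-inj = λ () ; col-inj = λ () ; sym-inj = λ () }

  NewSymbol : ∀ {t} → Partial L t → ℕ → Set
  NewSymbol T v = ∀ b → L (Partial.row T b) (Partial.col T b) ≢ v

  cons : ∀ {t} {A : Set} → A → (Fin t → A) → Fin (suc t) → A
  cons x f zero = x
  cons x f (suc a) = f a

  cons-inj : ∀ {t} {A : Set} {x : A} {f : Fin t → A} → Inj f → (∀ b → f b ≢ x) → Inj (cons x f)
  cons-inj fi new zero    zero    _ = refl
  cons-inj fi new zero    (suc b) e = contradiction (sym e) (new b)
  cons-inj fi new (suc a) zero    e = contradiction e (new a)
  cons-inj fi new (suc a) (suc b) e = cong suc (fi a b e)

  add : ∀ {t} (T : Partial L t) i j → ¬ RowCov T i → ¬ ColCov T j → NewSymbol T (L i j) →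
        Partial L (suc t)
  add T i j ¬r ¬c new = record
    { row     = cons i row
    ; col     = cons j col
    ; row-inj = cons-inj row-inj (λ b e → ¬r (b , e))
    ; col-inj = cons-inj col-inj (λ b e → ¬c (b , e))
    ; sym-inj = λ { zero    zero    _ → refl
                  ; zero    (suc b) e → contradiction (sym e) (new b)
                  ; (suc a) zero    e → contradiction e (new a)
                  ; (suc a) (suc b) e → cong suc (sym-inj a b e) }
    }
    where open Partial T

  add-⊒ : ∀ {t} (T : Partial L t) i j ¬r ¬c new → T ⊑ add T i j ¬r ¬c new
  add-⊒ T i j ¬r ¬c new = (λ { _ (b , e) → suc b , e }) , (λ { _ (b , e) → suc b , e })

  uncoveredCol : ∀ {t y} (T : Partial L t) (e : Fin y → Fin n) → Inj e → t < y → ∃ λ a → ¬ ColCov T (e a)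
  uncoveredCol T e e-inj t<y with pick (λ a b → Partial.col T b ≡ e a) (λ a b → Partial.col T b ≟ e a)
                                      (λ a a′ b p q → e-inj a a′ (trans (sym p) q)) t<y
  ... | a , new = a , λ { (b , p) → new b p }

  -- A cell of row i is blocked by its column or by its symbol, and each
  -- element of T accounts for at most one cell of either kind.
  extendRow : IsGenLatin n L → ∀ {t y} (T : Partial L t) i → ¬ RowCov T i →
              (e : Fin y → Fin n) → Inj e → t + t < y →
              ∃ λ a → ¬ ColCov T (e a) × NewSymbol T (L i (e a))
  extendRow (latin , _) {t} T i ¬r e e-inj lt with pick Bad bad? uniq lt
    where
    open Partial T
    Bad′ : Fin _ → Fin t ⊎ Fin t → Set
    Bad′ a (inj₁ b) = col b ≡ e a
    Bad′ a (inj₂ b) = L (row b) (col b) ≡ L i (e a)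
    Bad : Fin _ → Fin (t + t) → Set
    Bad a b = Bad′ a (splitAt t b)
    bad? : ∀ a b → Dec (Bad a b)
    bad? a b with splitAt t b
    ... | inj₁ b = col b ≟ e a
    ... | inj₂ b = L (row b) (col b) ≟ℕ L i (e a)
    uniq : ∀ a a′ b → Bad a b → Bad a′ b → a ≡ a′
    uniq a a′ b p q with splitAt t b
    ... | inj₁ b = e-inj a a′ (trans (sym p) q)
    ... | inj₂ b = e-inj a a′ (latin i _ _ (trans (sym p) q))
  ... | a , ok = a , (λ { (b , p) → lemma₁ b p }) , lemma₂
    where
    open Inverse (+↔⊎ {t} {t}) using (from; strictlyInverseˡ)
    open Partial T
    lemma₁ : ∀ b → col b ≢ e a
    lemma₁ b p with ok (from (inj₁ b))
    ... | h rewrite strictlyInverseˡ (inj₁ b) = h p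
    lemma₂ : ∀ b → L (row b) (col b) ≢ L i (e a)
    lemma₂ b p with ok (from (inj₂ b))
    ... | h rewrite strictlyInverseˡ (inj₂ b) = h p

  -- `n` distinct rows are all the rows, so a column can be read off for each row.
  transversal : Partial L n → HasTransversal n L
  transversal T = (λ i → col (proj₁ (surj i))) , σ-inj , distinct
    where
    open Partial T
    surj : ∀ i → RowCov T i
    surj i with rowCov? T i
    ... | yes c = c
    ... | no ¬c = contradiction (injective⇒≤ {f = cons i row} (λ {a} {b} → cons-inj row-inj (λ b e → ¬c (b , e)) a b)) (<⇒≱ ≤-refl)
    idx-inj : ∀ {i i′} → proj₁ (surj i) ≡ proj₁ (surj i′) → i ≡ i′
    idx-inj {i} {i′} e = trans (sym (proj₂ (surj i))) (trans (cong row e) (proj₂ (surj i′)))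
    σ-inj : Injective _≡_ _≡_ (λ i → col (proj₁ (surj i)))
    σ-inj e = idx-inj (col-inj _ _ e)
    distinct : ∀ i i′ → L i (col (proj₁ (surj i))) ≡ L i′ (col (proj₁ (surj i′))) → i ≡ i′
    distinct i i′ e = idx-inj (sym-inj _ _
      (subst₂ (λ r r′ → L r (col (proj₁ (surj i))) ≡ L r′ (col (proj₁ (surj i′)))) (sym (proj₂ (surj i))) (sym (proj₂ (surj i′))) e))

  -- Each addition starts from at most `t + w - 1` cells, and twice that number is below `n`, so
  -- `extendRow` can search all `n` columns. Rows already covered cost nothing.
  coverRows : IsGenLatin n L → ∀ {t} (T : Partial L t) w (e : Fin w → Fin n) →
              (t + w) + (t + w) ≤ suc n →
              ∃ λ t′ → t′ ≤ t + w × Σ (Partial L t′) λ T′ → T ⊑ T′ × (∀ a → RowCov T′ (e a))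
  coverRows lat {t} T zero e le = t , m≤m+n t 0 , T , ⊑-refl {T = T} , λ ()
  coverRows lat {t} T (suc w) e le with rowCov? T (e zero)
  ... | yes c with coverRows lat T w (e ∘ suc) (≤-trans (+-mono-≤ (+-monoʳ-≤ t (n≤1+n w)) (+-monoʳ-≤ t (n≤1+n w))) le)
  ...   | t′ , le′ , T′ , sub , cov = t′ , ≤-trans le′ (+-monoʳ-≤ t (n≤1+n w)) , T′ , sub ,
            λ { zero → proj₁ sub _ c ; (suc a) → cov a }
  coverRows lat {t} T (suc w) e le | no ¬c
    with extendRow lat T (e zero) ¬c id (λ _ _ p → p)
           (double-< (subst (suc t ≤_) (sym (+-suc t w)) (s≤s (m≤m+n t w))) le)
  ... | j , ¬cj , new with coverRows lat (add T (e zero) j ¬c ¬cj new) w (e ∘ suc) (subst (λ x → x + x ≤ suc n) (+-suc t w) le)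
  ...   | t′ , le′ , T′ , sub , cov = t′ , subst (t′ ≤_) (sym (+-suc t w)) le′ , T′ ,
            ⊑-trans {T = T} {T′ = add T (e zero) j ¬c ¬cj new} {T″ = T′} (add-⊒ T (e zero) j ¬c ¬cj new) sub ,
            λ { zero → proj₁ sub _ (zero , refl) ; (suc a) → cov a }

  -- Single cells and the exchange step.

  Single : Fin n → Fin n → Set
  Single i j = ∀ i′ j′ → L i′ j′ ≡ L i j → i′ ≡ i × j′ ≡ j

  single-new : ∀ {t} {T : Partial L t} {i j} → Single i j → ¬ RowCov T i → NewSymbol T (L i j)
  single-new s ¬r b e = ¬r (b , proj₁ (s _ _ e))

  -- First half of the exchange: a cell moves along its row to a single cell in column `y`. The new
  -- symbol occurs nowhere else, so symbols stay distinct, and the old column becomes free.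
  shift : ∀ {t} (T : Partial L t) s y → ¬ ColCov T y → Single (Partial.row T s) y →
          Σ (Partial L t) λ T′ → (∀ i → RowCov T i → RowCov T′ i) × (∀ i → RowCov T′ i → RowCov T i) ×
            (∀ j → ColCov T j → j ≡ Partial.col T s ⊎ ColCov T′ j) × ¬ ColCov T′ (Partial.col T s)
  shift {t} T s y ¬c sing = record { row = row ; col = col′ ; row-inj = row-inj ; col-inj = col′-inj ; sym-inj = sym-inj′ } ,
    (λ _ c → c) , (λ _ c → c) , keep , gone
    where
    open Partial T
    col′ : Fin t → Fin n
    col′ b with b ≟ s
    ... | yes _ = y
    ... | no _ = col b
    col′-inj : Inj col′
    col′-inj a b e with a ≟ s | b ≟ s
    ... | yes p | yes q = trans p (sym q)
    ... | yes p | no q = contradiction (b , sym e) ¬c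
    ... | no p | yes q = contradiction (a , e) ¬c
    ... | no p | no q = col-inj a b e
    sym-inj′ : Inj (λ a → L (row a) (col′ a))
    sym-inj′ a b e with a ≟ s | b ≟ s
    ... | yes p | yes q = trans p (sym q)
    ... | yes refl | no q = sym (row-inj _ _ (proj₁ (sing _ _ (sym e))))
    ... | no p | yes refl = row-inj _ _ (proj₁ (sing _ _ e))
    ... | no p | no q = sym-inj a b e
    keep : ∀ j → ColCov T j → j ≡ col s ⊎ (∃ λ b → col′ b ≡ j)
    keep j (b , e) with b ≟ s in eq
    ... | yes refl = inj₁ (sym e)
    ... | no q = inj₂ (b , h)
      where
      h : col′ b ≡ j
      h with b ≟ s
      ... | yes p = contradiction p q
      ... | no _ = e
    gone : ¬ (∃ λ b → col′ b ≡ col s)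
    gone (b , e) with b ≟ s
    ... | yes p = ¬c (s , sym e)
    ... | no q = q (col-inj _ _ e)

  -- If every neighbour (through single cells) of the
  -- uncovered row x and of the uncovered column y is covered, then by counting
  -- some element (r , c) of T has both (x , c) and (r , y) single.
  augment : ∀ {t d e x y} (T : Partial L t) → ¬ RowCov T x → ¬ ColCov T y →
            AtLeast d (Single x) → AtLeast e (λ i → Single i y) → t < d + e →
            Σ (Partial L (suc t)) λ T′ → T ⊑ T′
  augment {t} {d} {e} {x} {y} T ¬x ¬y (atLeast f f-inj f-single) (atLeast g g-inj g-single) lt
    with any? (λ a → ¬? (colCov? T (f a))) | any? (λ a → ¬? (rowCov? T (g a)))
  ... | yes (a , ¬c) | _ = add T x (f a) ¬x ¬c (single-new {T = T} (f-single a) ¬x) ,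
    add-⊒ T x (f a) ¬x ¬c (single-new {T = T} (f-single a) ¬x)
  ... | no _ | yes (a , ¬r) = add T (g a) y ¬r ¬y (single-new {T = T} (g-single a) ¬r) ,
    add-⊒ T (g a) y ¬r ¬y (single-new {T = T} (g-single a) ¬r)
  ... | no all-c | no all-r = swapped
    where
    open Partial T
    fc : ∀ a → ColCov T (f a)
    fc a = decidable-stable (colCov? T (f a)) (λ h → all-c (a , h))
    gc : ∀ a → RowCov T (g a)
    gc a = decidable-stable (rowCov? T (g a)) (λ h → all-r (a , h))
    common : ∃₂ λ a b → proj₁ (fc a) ≡ proj₁ (gc b)
    common with any? (λ a → any? (λ b → proj₁ (fc a) ≟ proj₁ (gc b)))
    ... | yes h = h
    ... | no ¬h = contradiction (disjoint-≤ (proj₁ ∘ fc) (proj₁ ∘ gc)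
      (λ a a′ p → f-inj a a′ (trans (sym (proj₂ (fc a))) (trans (cong col p) (proj₂ (fc a′)))))
      (λ a a′ p → g-inj a a′ (trans (sym (proj₂ (gc a))) (trans (cong row p) (proj₂ (gc a′)))))
      (λ a b p → ¬h (a , b , p))) (<⇒≱ lt)
    swapped : Σ (Partial L (suc t)) λ T′ → T ⊑ T′
    swapped with common
    ... | a , b , p with gc b | fc a
    ... | s , r | s′ , c with p
    ... | refl with shift T s y ¬y (subst (λ r → Single r y) (sym r) (g-single b))
    ... | T₁ , r⊑ , ⊑r , c⊑ , gone =
      add T₁ x (col s) ¬x₁ gone new ,
      (λ i h → proj₁ (add-⊒ T₁ x (col s) ¬x₁ gone new) i (r⊑ i h)) , cc
      where
      ¬x₁ : ¬ RowCov T₁ x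
      ¬x₁ h = ¬x (⊑r x h)
      new : NewSymbol T₁ (L x (col s))
      new = single-new {T = T₁} (subst (Single x) (sym c) (f-single a)) ¬x₁
      cc : ∀ j → ColCov T j → ColCov (add T₁ x (col s) ¬x₁ gone new) j
      cc j h with c⊑ j h
      -- The column freed by `shift` is taken by the added cell, so no covered column is lost.
      ... | inj₁ refl = zero , refl
      ... | inj₂ (b , q) = suc b , q

-- Inequalities between the sizes involved.

am-gm-≤ : ∀ x y → x ≤ y → 4 * (x * y) ≤ (x + y) * (x + y)
am-gm-≤ x y x≤y with m≤n⇒∃[o]m+o≡n x≤y
-- With `y = x + e` the two sides differ by `e * e`.
... | e , refl = ≤-trans (m≤m+n _ (e * e)) (≤-reflexive (square x e))
  where
  square : ∀ x e → 4 * (x * (x + e)) + e * e ≡ (x + (x + e)) * (x + (x + e))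
  square = solve-∀

am-gm : ∀ x y → 4 * (x * y) ≤ (x + y) * (x + y)
am-gm x y with ≤-total x y
... | inj₁ h = am-gm-≤ x y h
... | inj₂ h = subst₂ _≤_ (prod x y) (sq x y) (am-gm-≤ y x h)
  where
  prod : ∀ x y → 4 * (y * x) ≡ 4 * (x * y)
  prod = solve-∀
  sq : ∀ x y → (y + x) * (y + x) ≡ (x + y) * (x + y)
  sq = solve-∀

⌈n/2⌉≤1+⌊n/2⌋ : ∀ n → ⌈ n /2⌉ ≤ suc ⌊ n /2⌋
⌈n/2⌉≤1+⌊n/2⌋ zero = z≤n
⌈n/2⌉≤1+⌊n/2⌋ (suc zero) = s≤s z≤n
⌈n/2⌉≤1+⌊n/2⌋ (suc (suc n)) = s≤s (⌈n/2⌉≤1+⌊n/2⌋ n)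

-- Add `s ≤ ⌊ p /2⌋` and `s + 1 ≤ ⌈ p /2⌉`.
<⌈n/2⌉⇒double-< : ∀ {s p} → s < ⌈ p /2⌉ → s + s < p
<⌈n/2⌉⇒double-< {s} {p} lt = subst (s + s <_) (⌊n/2⌋+⌈n/2⌉≡n p)
  (subst (_≤ ⌊ p /2⌋ + ⌈ p /2⌉) (+-suc s s) (+-mono-≤ (≤-pred (≤-trans lt (⌈n/2⌉≤1+⌊n/2⌋ p))) lt))

n≤⌈n/2⌉+⌈n/2⌉ : ∀ n → n ≤ ⌈ n /2⌉ + ⌈ n /2⌉
n≤⌈n/2⌉+⌈n/2⌉ n = subst (_≤ ⌈ n /2⌉ + ⌈ n /2⌉) (⌊n/2⌋+⌈n/2⌉≡n n) (+-monoˡ-≤ _ (⌊n/2⌋≤⌈n/2⌉ n))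

-- After doubling, `2p′ ≥ 2d > n` leaves less than `n` for `2p`.
less-than-half : ∀ {p p′ d n} → p + p′ ≤ n → d ≤ p′ → n < d + d → p + p < n
less-than-half {p} {p′} {d} {n} pn dp nd = +-cancelʳ-≤ n (suc (p + p)) n (begin
  suc (p + p) + n     ≡⟨ +-suc (p + p) n ⟨
  p + p + suc n       ≤⟨ +-monoʳ-≤ (p + p) (≤-trans nd (+-mono-≤ dp dp)) ⟩
  p + p + (p′ + p′)   ≡⟨ rearrange p p′ ⟩
  p + p′ + (p + p′)   ≤⟨ +-mono-≤ pn pn ⟩
  n + n               ∎)
  where
  open ≤-Reasoning
  rearrange : ∀ p p′ → p + p + (p′ + p′) ≡ p + p′ + (p + p′)
  rearrange = solve-∀

-- Consecutive squares differ by `2m + 1`.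
squares-close : ∀ m → suc m * suc m ≤ m * m + 3 → m ≤ 1
squares-close m le = *-cancelˡ-≤ 2 (+-cancelʳ-≤ (m * m + 1) (2 * m) 2
  (subst₂ _≤_ (l m) (r m) le))
  where
  l : ∀ m → suc m * suc m ≡ 2 * m + (m * m + 1)
  l = solve-∀
  r : ∀ m → m * m + 3 ≡ 2 + (m * m + 1)
  r = solve-∀

-- Here p and q count the rows and the columns without single cells, p′ and q′
-- the others. Otherwise p′ + 2q′ ≤ 2(n − 1), and 8p′q′ ≤ (p′ + 2q′)² leaves too
-- little room for k symbols.
weighted-sum-≤ : ∀ {n k p p′ q q′} → p + p′ ≤ n → q + q′ ≤ n → q + q < n →
                 k + k ≤ n * n + p′ * q′ → 3 * (n * n) ≤ 4 * k + 3 → p + (q + q) ≤ suc n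
weighted-sum-≤ {zero} _ _ () _ _
weighted-sum-≤ {suc m} {k} {p} {p′} {q} {q′} pn qn q<n 2k 4k with p + (q + q) ≤? suc (suc m)
... | yes h = h
... | no ¬h = contradiction m≤1 (<⇒≱ (≤-pred 3≤n))
  where
  open ≤-Reasoning
  n : ℕ
  n = suc m
  big : suc (suc n) ≤ p + (q + q)
  big = ≰⇒> ¬h
  -- From `q + q < n` and `n + 2 ≤ p + 2q` follows `3 ≤ p ≤ n`, which makes `m ≤ 1` absurd.
  3≤n : 3 ≤ n
  3≤n = ≤-trans (+-cancelʳ-≤ (q + q) 3 p (≤-trans (s≤s (s≤s q<n)) big)) (≤-trans (m≤m+n p p′) pn)
  sum-≤ : p′ + (q′ + q′) ≤ m + m
  sum-≤ = +-cancelʳ-≤ (suc (suc n)) _ _ (begin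
    p′ + (q′ + q′) + suc (suc n)        ≤⟨ +-monoʳ-≤ (p′ + (q′ + q′)) big ⟩
    p′ + (q′ + q′) + (p + (q + q))      ≡⟨ e₁ p p′ q q′ ⟩
    p + p′ + ((q + q′) + (q + q′))      ≤⟨ +-mono-≤ pn (+-mono-≤ qn qn) ⟩
    n + (n + n)                         ≡⟨ e₂ m ⟩
    m + m + suc (suc n)                 ∎)
    where
    e₁ : ∀ p p′ q q′ → p′ + (q′ + q′) + (p + (q + q)) ≡ p + p′ + ((q + q′) + (q + q′))
    e₁ = solve-∀
    e₂ : ∀ m → suc m + (suc m + suc m) ≡ m + m + suc (suc (suc m))
    e₂ = solve-∀
  prod-≤ : 2 * (p′ * q′) ≤ m * m
  prod-≤ = *-cancelˡ-≤ 4 (begin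
    4 * (2 * (p′ * q′))                      ≡⟨ e₁ p′ q′ ⟩
    4 * (p′ * (q′ + q′))                     ≤⟨ am-gm p′ (q′ + q′) ⟩
    (p′ + (q′ + q′)) * (p′ + (q′ + q′))      ≤⟨ *-mono-≤ sum-≤ sum-≤ ⟩
    (m + m) * (m + m)                        ≡⟨ e₂ m ⟩
    4 * (m * m)                              ∎)
    where
    e₁ : ∀ a b → 4 * (2 * (a * b)) ≡ 4 * (a * (b + b))
    e₁ = solve-∀
    e₂ : ∀ m → (m + m) * (m + m) ≡ 4 * (m * m)
    e₂ = solve-∀
  -- Cancelling `2n²` from `3n² ≤ 2n² + 2p′q′ + 3` leaves `(m + 1)² ≤ m² + 3`.
  m≤1 : m ≤ 1
  m≤1 = squares-close m (+-cancelˡ-≤ (2 * (n * n)) _ _ (begin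
    2 * (n * n) + n * n              ≡⟨ e₁ (n * n) ⟩
    3 * (n * n)                      ≤⟨ 4k ⟩
    4 * k + 3                        ≡⟨ e₂ k ⟩
    2 * (k + k) + 3                  ≤⟨ +-monoˡ-≤ 3 (*-monoʳ-≤ 2 2k) ⟩
    2 * (n * n + p′ * q′) + 3        ≡⟨ e₃ (n * n) (p′ * q′) ⟩
    2 * (n * n) + (2 * (p′ * q′) + 3) ≤⟨ +-monoʳ-≤ (2 * (n * n)) (+-monoˡ-≤ 3 prod-≤) ⟩
    2 * (n * n) + (m * m + 3)        ∎))
    where
    e₁ : ∀ x → 2 * x + x ≡ 3 * x
    e₁ = solve-∀
    e₂ : ∀ k → 4 * k + 3 ≡ 2 * (k + k) + 3
    e₂ = solve-∀
    e₃ : ∀ x y → 2 * (x + y) + 3 ≡ 2 * x + (2 * y + 3)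
    e₃ = solve-∀

-- The size u of a transversal between the p rows and the q columns to be
-- covered: u = min(q, ⌈p/2⌉) can be reached greedily, and it saves enough for
-- the w remaining columns to be covered greedily as well.
crossing-size : ∀ {p q n} → p + p < n → p + (q + q) ≤ suc n →
                ∃ λ u → u ≤ q × (∀ s → s < u → s + s < p) ×
                  (∀ w → u + w ≤ q → (p + w) + (p + w) ≤ suc n)
crossing-size {p} {q} {n} p<n le with q ≤? ⌈ p /2⌉
... | yes h = q , ≤-refl , (λ s lt → <⌈n/2⌉⇒double-< (<-≤-trans lt h)) , bound
  where
  -- With `u = q` no column remains, so only `w = 0` occurs.
  bound : ∀ w → q + w ≤ q → (p + w) + (p + w) ≤ suc n
  bound zero _ rewrite +-identityʳ p = ≤-trans (n≤1+n _) (≤-trans p<n (n≤1+n n))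
  bound (suc w) h = contradiction h (m+1+n≰m q)
... | no ¬h = u , ≤-trans (n≤1+n _) (≰⇒> ¬h) , (λ s → <⌈n/2⌉⇒double-<) , bound
  where
  open ≤-Reasoning
  u : ℕ
  u = ⌈ p /2⌉
  -- Here `p ≤ 2u`, so `2(p + w) ≤ p + 2(u + w) ≤ p + 2q`.
  bound : ∀ w → u + w ≤ q → (p + w) + (p + w) ≤ suc n
  bound w h = begin
    (p + w) + (p + w)           ≡⟨ e₁ p w ⟩
    p + (p + (w + w))           ≤⟨ +-monoʳ-≤ p (+-monoˡ-≤ (w + w) (n≤⌈n/2⌉+⌈n/2⌉ p)) ⟩
    p + ((u + u) + (w + w))     ≡⟨ e₂ p u w ⟩
    p + ((u + w) + (u + w))     ≤⟨ +-monoʳ-≤ p (+-mono-≤ h h) ⟩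
    p + (q + q)                 ≤⟨ le ⟩
    suc n                       ∎
    where
    e₁ : ∀ p w → (p + w) + (p + w) ≡ p + (p + (w + w))
    e₁ = solve-∀
    e₂ : ∀ p u w → p + ((u + u) + (w + w)) ≡ p + ((u + w) + (u + w))
    e₂ = solve-∀

-- Covering the rows and columns without single cells.

-- The members of `P` listed by `f` lie in `R`, those enumerated by `W` do not. With `R` meaning
-- covered, this bounds what the crossing cells leave to the later stages.
remaining-≤ : ∀ {n c t w} {P R : Fin n → Set} → Enum P c → (f : Fin t → Fin n) → Inj f → (∀ b → P (f b)) →
         (∀ b → R (f b)) → Enum (λ i → P i × ¬ R i) w → t + w ≤ c
remaining-≤ {P = P} {R} E f f-inj f-P f-R W = disjoint-≤
  (λ b → index (f b) (f-P b)) (λ a → index (W.el a) (proj₁ (W.sound a)))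
  (λ a b e → f-inj a b (index-injective {p = f-P a} {f-P b} e))
  (λ a b e → W.inj a b (index-injective {p = proj₁ (W.sound a)} {proj₁ (W.sound b)} e))
  (λ a b e → proj₂ (W.sound b) (subst R (index-injective {p = f-P a} {proj₁ (W.sound b)} e) (f-R a)))
  where
  open Enum E
  module W = Enum W

empty-enum : ∀ {n c} {P : Fin n → Set} → Enum P c → ¬ ∃ P → c ≡ 0
empty-enum {c = zero} _ _ = refl
empty-enum {c = suc _} E ¬p = contradiction (Enum.el E zero , Enum.sound E zero) ¬p

complement-≤ : ∀ {n c d} {P : Fin n → Set} → Enum (¬_ ∘ P) c → Enum P d → c + d ≤ n
complement-≤ {P = P} E F = disjoint-≤ E.el F.el E.inj F.inj
  (λ a b e → E.sound a (subst P (sym e) (F.sound b)))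
  where
  module E = Enum E
  module F = Enum F

atLeast-≤ : ∀ {n c d} {P Q : Fin n → Set} → AtLeast c P → (∀ i → P i → Q i) → Enum Q d → c ≤ d
atLeast-≤ (atLeast f f-inj h) imp E = injective⇒≤ {f = λ a → index (f a) (imp _ (h a))}
  (λ {a} {b} e → f-inj a b (index-injective {p = imp _ (h a)} {imp _ (h b)} e))
  where open Enum E

module _ {n} {L : Square n} where

  -- The next cell is sought in an uncovered column of `Q`. Each of the `t` earlier cells rules out
  -- at most two of the `p` candidates there, one by its row and one by its symbol, and `t + t < p`.
  crossing : IsGenLatin n L → ∀ {P Q : Fin n → Set} {p q} → Enum P p → Enum Q q →
             ∀ t → t ≤ q → (∀ s → s < t → s + s < p) →
             Σ (Partial L t) λ T → (∀ b → P (Partial.row T b)) × (∀ b → Q (Partial.col T b))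
  crossing lat EP EQ zero _ _ = empty , (λ ()) , (λ ())
  crossing lat EP EQ (suc t) t<q room with crossing lat EP EQ t (≤-trans (n≤1+n t) t<q) (λ s → room s ∘ m≤n⇒m≤1+n)
  ... | T , inP , inQ with uncoveredCol T (Enum.el EQ) (Enum.inj EQ) t<q
  ... | b , ¬cb with extendRow (transpose-latin lat) (transposeᵖ T) (Enum.el EQ b) ¬cb (Enum.el EP) (Enum.inj EP) (room t ≤-refl)
  ... | a , ¬ra , new = add T (Enum.el EP a) (Enum.el EQ b) ¬ra ¬cb new ,
    (λ { zero → Enum.sound EP a ; (suc c) → inP c }) , (λ { zero → Enum.sound EQ b ; (suc c) → inQ c })

  -- Three stages: `u` cells in `P × Q`, then the `w` other rows of `P`, then the `v` columns of `Q`
  -- missed by the first stage. Two stages use at most `u + w ≤ p` cells, and `u + v ≤ q` lets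
  -- `crossing-size` bound the third.
  coverBoth : IsGenLatin n L → ∀ {P Q : Fin n → Set} {p q} → Decidable P → Decidable Q →
              Enum P p → Enum Q q → p + p < n → p + (q + q) ≤ suc n →
              ∃ λ t → Σ (Partial L t) λ T → (∀ i → P i → RowCov T i) × (∀ j → Q j → ColCov T j)
  coverBoth lat {P} {Q} {p} {q} P? Q? EP EQ p<n le
    with crossing-size {p} {q} {n} p<n le
  ... | u , u≤q , room , bound
    with crossing lat EP EQ u u≤q room
  ... | T₁ , inP , inQ
    with enumerate (λ i → P? i ×-dec ¬? (rowCov? T₁ i)) | enumerate (λ j → Q? j ×-dec ¬? (colCov? T₁ j))
  ... | w , W | v , V
    with remaining-≤ {R = RowCov T₁} EP (Partial.row T₁) (Partial.row-inj T₁) inP (λ b → b , refl) W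
       | remaining-≤ {R = ColCov T₁} EQ (Partial.col T₁) (Partial.col-inj T₁) inQ (λ b → b , refl) V
  ... | u+w≤p | u+v≤q
    with coverRows lat T₁ w (Enum.el W)
           (≤-trans (+-mono-≤ u+w≤p u+w≤p) (≤-trans (n≤1+n _) (≤-trans p<n (n≤1+n n))))
  ... | t₂ , t₂≤ , T₂ , ⊑₂ , cov₂
    with +-monoˡ-≤ v (≤-trans t₂≤ u+w≤p)
  ... | t₂+v≤
    with coverRows (transpose-latin lat) (transposeᵖ T₂) v (Enum.el V)
           (≤-trans (+-mono-≤ t₂+v≤ t₂+v≤) (bound v u+v≤q))
  ... | t₃ , _ , T₃ , (⊑c , ⊑r) , cov₃ = t₃ , transposeᵖ T₃ , rows , cols
    where
    rows : ∀ i → P i → RowCov (transposeᵖ T₃) i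
    rows i pi with rowCov? T₁ i
    ... | yes c = ⊑r i (proj₁ ⊑₂ i c)
    ... | no ¬c with Enum.complete W i (pi , ¬c)
    ...   | a , refl = ⊑r i (cov₂ a)
    cols : ∀ j → Q j → ColCov (transposeᵖ T₃) j
    cols j qj with colCov? T₁ j
    ... | yes c = ⊑c j (proj₂ ⊑₂ j c)
    ... | no ¬c with Enum.complete V j (qj , ¬c)
    ...   | a , refl = cov₃ a

  -- Counting symbols, and completing a transversal when single cells abound.

  Repeated : Fin n → Fin n → Set
  Repeated i j = ∃₂ λ i′ j′ → L i′ j′ ≡ L i j × ¬ (i′ ≡ i × j′ ≡ j)

  single⊎repeated : ∀ i j → Single {L = L} i j ⊎ Repeated i j
  single⊎repeated i j with any? (λ i′ → any? (λ j′ → (L i′ j′ ≟ℕ L i j) ×-dec ¬? ((i′ ≟ i) ×-dec (j′ ≟ j))))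
  ... | yes r = inj₂ r
  ... | no ¬r = inj₁ λ i′ j′ e → decidable-stable ((i′ ≟ i) ×-dec (j′ ≟ j)) λ h → ¬r (i′ , j′ , e , h)

  single? : ∀ i j → Dec (Single {L = L} i j)
  single? i j with single⊎repeated i j
  ... | inj₁ s = yes s
  ... | inj₂ (i′ , j′ , e , h) = no λ s → h (s i′ j′ e)

  SingleRow SingleCol : Fin n → Set
  SingleRow i = ∃ λ j → Single {L = L} i j
  SingleCol j = ∃ λ i → Single {L = L} i j

  singleRow? : Decidable SingleRow
  singleRow? i = any? (single? i)

  singleCol? : Decidable SingleCol
  singleCol? j = any? (λ i → single? i j)

  -- A symbol occupies at least two cells unless it is single, and the single
  -- cells lie in the rows and columns enumerated by A and B.
  symbols-≤ : ∀ {k a b} → HasAtLeastSymbols n L k → Enum SingleRow a → Enum SingleCol b →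
              k + k ≤ n * n + a * b
  symbols-≤ {k} {a} {b} (c , c-inj) A B =
    -- The first copy of a symbol goes to its chosen cell. The second goes to another occurrence or,
    -- for a single cell, to the indices of its row and column.
    card-≤ +↔⊎ (↔-trans +↔⊎ (*↔× ⊎-↔ *↔×)) (λ { (inj₁ x) → inj₁ (c x) ; (inj₂ x) → second x (single⊎repeated _ _) })
      λ { (inj₁ x) (inj₁ y) e → cong inj₁ (c-inj x y (cong L′ (inj₁-injective e)))
        ; (inj₁ x) (inj₂ y) e → contradiction (sym e) (second≢ y x _)
        ; (inj₂ x) (inj₁ y) e → contradiction e (second≢ x y _)
        ; (inj₂ x) (inj₂ y) e → cong inj₂ (second-inj x y _ _ e) }
    where
    module A = Enum A
    module B = Enum B
    L′ : Fin n × Fin n → ℕ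
    L′ (i , j) = L i j
    SR : Fin k → Set
    SR x = Single {L = L} (proj₁ (c x)) (proj₂ (c x)) ⊎ Repeated (proj₁ (c x)) (proj₂ (c x))
    second : ∀ x → SR x → (Fin n × Fin n) ⊎ (Fin a × Fin b)
    second x (inj₁ s) = inj₂ (A.index _ (_ , s) , B.index _ (_ , s))
    second x (inj₂ (i , j , _)) = inj₁ (i , j)
    second≢ : ∀ x y s → second x s ≢ inj₁ (c y)
    second≢ x y (inj₂ (i , j , e , ne)) p with inj₁-injective p
    ... | q with c-inj x y (trans (sym e) (cong L′ q))
    ... | refl = ne (,-injective q)
    second-inj : ∀ x y s s′ → second x s ≡ second y s′ → x ≡ y
    second-inj x y (inj₁ s) (inj₁ s′) p with ,-injective (inj₂-injective p)
    ... | e , e′ = c-inj x y (cong₂ L (A.index-injective {p = _ , s} {_ , s′} e) (B.index-injective {p = _ , s} {_ , s′} e′))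
    second-inj x y (inj₂ (i , j , e , _)) (inj₂ (i′ , j′ , e′ , _)) p =
      c-inj x y (trans (sym e) (trans (cong L′ (inj₁-injective p)) e′))

  Rich : ℕ → Set
  Rich d = ∀ i j → Single {L = L} i j → AtLeast d (Single {L = L} i) × AtLeast d (λ i′ → Single {L = L} i′ j)

  -- `g` counts the missing cells. An uncovered row and an uncovered column must contain single
  -- cells, hence at least `d + d > n ≥ t` together, and `augment` applies. Covered rows and columns
  -- stay covered, so the hypotheses persist.
  complete : ∀ {d} → Rich d → n < d + d → ∀ g {t} → t + g ≡ n → (T : Partial L t) →
             (∀ i → ¬ SingleRow i → RowCov T i) → (∀ j → ¬ SingleCol j → ColCov T j) → Partial L n
  complete rich lt zero eq T rows cols = subst (Partial L) (trans (sym (+-identityʳ _)) eq) T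
  complete {d} rich lt (suc g) {t} eq T rows cols
    with uncoveredCol (transposeᵖ T) id (λ _ _ e → e) t<n | uncoveredCol T id (λ _ _ e → e) t<n
    where
    t<n : t < n
    t<n = subst (t <_) eq (subst (suc t ≤_) (sym (+-suc t g)) (s≤s (m≤m+n t g)))
  ... | x , ¬x | y , ¬y
    with decidable-stable (singleRow? x) (λ h → ¬x (rows x h)) | decidable-stable (singleCol? y) (λ h → ¬y (cols y h))
  ... | j , s | i , s′
    with augment T ¬x ¬y (proj₁ (rich x j s)) (proj₂ (rich i y s′))
           (≤-<-trans (≤-trans (m≤m+n t (suc g)) (≤-reflexive eq)) lt)
  ... | T′ , r , c = complete rich lt g (trans (sym (+-suc t g)) eq) T′ (λ i → r i ∘ rows i) (λ j → c j ∘ cols j)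

  -- Otherwise every symbol occurs at least twice, so `2k ≤ n²` and then `n² ≤ 3`. Without a single
  -- cell, `Rich` would be vacuous.
  single-exists : ∀ {k} → HasAtLeastSymbols n L k → 3 * (n * n) ≤ 4 * k + 3 → 1 < n →
                  ∃₂ λ i j → Single {L = L} i j
  single-exists {k} syms 4k 1<n with any? singleRow?
  ... | yes h = h
  ... | no ¬h = contradiction n²≤3 (<⇒≱ (*-mono-≤ 1<n 1<n))
    where
    open ≤-Reasoning
    e₁ : ∀ x → 2 * x + x ≡ 3 * x
    e₁ = solve-∀
    e₂ : ∀ k → 4 * k + 3 ≡ 2 * (k + k) + 3
    e₂ = solve-∀
    2k : k + k ≤ n * n
    2k with enumerate singleRow? | enumerate singleCol?
    ... | a , A | b , B = begin
      k + k              ≤⟨ symbols-≤ syms A B ⟩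
      n * n + a * b      ≡⟨ cong (λ c → n * n + c * b) (empty-enum A ¬h) ⟩
      n * n + 0          ≡⟨ +-identityʳ (n * n) ⟩
      n * n              ∎
    n²≤3 : n * n ≤ 3
    n²≤3 = +-cancelˡ-≤ (2 * (n * n)) _ _ (begin
      2 * (n * n) + n * n        ≡⟨ e₁ (n * n) ⟩
      3 * (n * n)                ≤⟨ 4k ⟩
      4 * k + 3                  ≡⟨ e₂ k ⟩
      2 * (k + k) + 3            ≤⟨ +-monoˡ-≤ 3 (*-monoʳ-≤ 2 2k) ⟩
      2 * (n * n) + 3            ∎)

  rich-transversal : ∀ {d k} → IsGenLatin n L → HasAtLeastSymbols n L k → 3 * (n * n) ≤ 4 * k + 3 → 1 < n →
                     Rich d → n < d + d → HasTransversal n L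
  rich-transversal {d} {k} lat syms 4k 1<n rich lt =
    finish (coverEnums (proj₂ (enumerate singleRow?)) (proj₂ (enumerate singleCol?))
      (proj₂ (enumerate (¬? ∘ singleRow?))) (proj₂ (enumerate (¬? ∘ singleCol?))))
    where
    Covered : ℕ → Set
    Covered t = Σ (Partial L t) λ T → (∀ i → ¬ SingleRow i → RowCov T i) × (∀ j → ¬ SingleCol j → ColCov T j)
    coverEnums : ∀ {a b p q} → Enum SingleRow a → Enum SingleCol b → Enum (¬_ ∘ SingleRow) p → Enum (¬_ ∘ SingleCol) q →
                 ∃ Covered
    coverEnums {a} {b} {p} {q} A B P Q with single-exists syms 4k 1<n
    ... | i₀ , j₀ , s₀ = coverBoth lat (¬? ∘ singleRow?) (¬? ∘ singleCol?) P Q 2p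
                           (weighted-sum-≤ {n} {k} {p} {a} {q} {b} pa qb 2q (symbols-≤ syms A B) 4k)
      where
      pa : p + a ≤ n
      pa = complement-≤ P A
      qb : q + b ≤ n
      qb = complement-≤ Q B
      -- The `d` single cells of column `j₀` lie in different rows, so more than half of the rows
      -- contain single cells.
      2p : p + p < n
      2p = less-than-half pa (atLeast-≤ (proj₂ (rich i₀ j₀ s₀)) (λ i s → j₀ , s) A) lt
      2q : q + q < n
      2q = less-than-half qb (atLeast-≤ (proj₁ (rich i₀ j₀ s₀)) (λ j s → i₀ , s) B) lt
    finish : ∃ Covered → HasTransversal n L
    finish (t , T , rows , cols) with m≤n⇒∃[o]m+o≡n (injective⇒≤ {f = Partial.row T} (λ {a} {b} → Partial.row-inj T a b))
    ... | g , eq = transversal (complete rich lt g eq T rows cols)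

-- Deleting the row and the column of a single cell.

-- The values that disappear with row `i` and column `j`. A value absent from `L` satisfies this
-- too, hence the separate hypothesis of occurrence in `lost⇒single-row`.
Lost : ∀ {n} → Square n → Fin n → Fin n → ℕ → Set
Lost L i j v = ∀ i′ j′ → L i′ j′ ≡ v → i′ ≡ i ⊎ j′ ≡ j

-- A symbol confined to row i and column j either meets column j outside
-- row i, which happens for at most m symbols, or is a single in row i.
lost⇒single-row : ∀ {m} {L : Square (suc m)} → IsGenLatin (suc m) L → ∀ i j {x d} (v : Fin x → ℕ) → Inj v →
                  (∀ a → ∃₂ λ i₀ j₀ → L i₀ j₀ ≡ v a) → (∀ a → Lost L i j (v a)) →
                  suc m + d ≤ suc x → AtLeast d (Single {L = L} i)
lost⇒single-row {m} {L} (rows , _) i j {x} {d} v v-inj occurs lost le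
  with split (suc m) d {InColumn} {InRow} classify le
  where
  InColumn InRow : Fin x → Set
  InColumn a = ∃ λ i′ → L i′ j ≡ v a × i ≢ i′
  InRow a = ∃ λ j′ → L i j′ ≡ v a × Single {L = L} i j′
  classify : ∀ a → InColumn a ⊎ InRow a
  classify a with any? (λ i′ → (L i′ j ≟ℕ v a) ×-dec ¬? (i ≟ i′))
  ... | yes h = inj₁ h
  ... | no ¬h = inj₂ (here (occurs a))
    where
    column : ∀ {i′ j′} → j′ ≡ j → L i′ j′ ≡ v a → i′ ≡ i
    column {i′} refl e = sym (decidable-stable (i ≟ i′) λ ne → ¬h (i′ , e , ne))
    -- No occurrence in column `j` lies outside row `i`, so all lie in row `i`, where the Latin
    -- condition allows only one.
    row : ∀ {i′ j′} → L i′ j′ ≡ v a → i′ ≡ i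
    row e = [ id , (λ p → column p e) ]′ (lost a _ _ e)
    here : (∃₂ λ i₀ j₀ → L i₀ j₀ ≡ v a) → InRow a
    here (i₀ , j₀ , e₀) with row e₀
    ... | refl = j₀ , e₀ , single
      where
      single : Single {L = L} i j₀
      single i′ j′ e with row (trans e e₀)
      ... | refl = refl , rows i _ _ e
-- Here `m + 1` different symbols of column `j` would sit in the `m` rows other than `i`.
... | inj₁ (atLeast f f-inj h) = contradiction
  (injective⇒≤ {f = λ a → punchOut (proj₂ (proj₂ (h a)))}
    λ {a} {b} e → f-inj a b (v-inj _ _ (trans (sym (proj₁ (proj₂ (h a))))
      (trans (cong (λ r → L r j) (punchOut-injective (proj₂ (proj₂ (h a))) (proj₂ (proj₂ (h b))) e))
        (proj₁ (proj₂ (h b)))))))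
  (<⇒≱ ≤-refl)
... | inj₂ (atLeast f f-inj h) = atLeast (proj₁ ∘ h)
  (λ a b e → f-inj a b (v-inj _ _ (trans (sym (proj₁ (proj₂ (h a))))
    (trans (cong (L i) e) (proj₁ (proj₂ (h b)))))))
  (λ a → proj₂ (proj₂ (h a)))

minor : ∀ {m} → Square (suc m) → Fin (suc m) → Fin (suc m) → Square m
minor L i j a b = L (punchIn i a) (punchIn j b)

minor-latin : ∀ {m} {L : Square (suc m)} i j → IsGenLatin (suc m) L → IsGenLatin m (minor L i j)
minor-latin i j (rows , cols) =
  (λ a b b′ e → punchIn-injective j b b′ (rows _ _ _ e)) , (λ a a′ b e → punchIn-injective i a a′ (cols _ _ _ e))

-- The symbol of a single cell does not occur in the minor, so the cell can be added to any
-- transversal found there.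
minor-transversal : ∀ {m} {L : Square (suc m)} {i j} → Single {L = L} i j → HasTransversal m (minor L i j) →
                    HasTransversal (suc m) L
minor-transversal {m} {L} {i} {j} s (σ , σ-inj , distinct) = transversal
  (add T i j (λ { (b , e) → punchInᵢ≢i i b e }) (λ { (b , e) → punchInᵢ≢i j (σ b) e })
    (λ b e → punchInᵢ≢i i b (proj₁ (s _ _ e))))
  where
  T : Partial L m
  T = record
    { row = punchIn i ; col = punchIn j ∘ σ
    ; row-inj = punchIn-injective i
    ; col-inj = λ a b e → σ-inj (punchIn-injective j _ _ e)
    ; sym-inj = distinct }

-- For each single cell, either `s` symbols survive the deletion and the minor has a transversal, or
-- `x` are lost, which yields `d` single cells in the row and, by transposition, in the column.
minor-or-rich : ∀ {m k s x d} {L : Square (suc m)} → IsGenLatin (suc m) L → HasAtLeastSymbols (suc m) L k →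
                (∀ i j → HasAtLeastSymbols m (minor L i j) s → HasTransversal m (minor L i j)) →
                x + s ≤ suc k → suc m + d ≤ suc x → HasTransversal (suc m) L ⊎ Rich {L = L} d
minor-or-rich {m} {k} {s} {x} {d} {L} lat (c , c-inj) IH xs md = choice λ i → choice λ j → at i j
  where
  v : Fin k → ℕ
  v a = L (proj₁ (c a)) (proj₂ (c a))
  Survives : Fin (suc m) → Fin (suc m) → Fin k → Set
  Survives i j a = ∃₂ λ i′ j′ → L i′ j′ ≡ v a × i ≢ i′ × j ≢ j′
  classify : ∀ i j a → Lost L i j (v a) ⊎ Survives i j a
  classify i j a with any? (λ i′ → any? (λ j′ → (L i′ j′ ≟ℕ v a) ×-dec ¬? (i ≟ i′) ×-dec ¬? (j ≟ j′)))
  ... | yes h = inj₂ h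
  ... | no ¬h = inj₁ lost
    where
    lost : Lost L i j (v a)
    lost i′ j′ e with i ≟ i′ | j ≟ j′
    ... | yes p | _ = inj₁ (sym p)
    ... | no _ | yes q = inj₂ (sym q)
    ... | no p | no q = contradiction (i′ , j′ , e , p , q) ¬h
  survivors : ∀ i j → AtLeast s (Survives i j) → HasAtLeastSymbols m (minor L i j) s
  survivors i j (atLeast f f-inj h) = cell ,
    λ a b e → f-inj a b (c-inj _ _ (trans (sym (symbol a)) (trans e (symbol b))))
    where
    cell : Fin s → Fin m × Fin m
    cell a = let (_ , _ , _ , p , q) = h a in punchOut p , punchOut q
    symbol : ∀ a → minor L i j (proj₁ (cell a)) (proj₂ (cell a)) ≡ v (f a)
    symbol a = let (_ , _ , e , p , q) = h a in trans (cong₂ L (punchIn-punchOut p) (punchIn-punchOut q)) e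
  at : ∀ i j → HasTransversal (suc m) L ⊎
       (Single {L = L} i j → AtLeast d (Single {L = L} i) × AtLeast d (λ i′ → Single {L = L} i′ j))
  at i j with single? {L = L} i j
  ... | no ¬s = inj₂ λ s → contradiction s ¬s
  ... | yes sg with split x s (classify i j) xs
  ...   | inj₂ surv = inj₁ (minor-transversal sg (IH i j (survivors i j surv)))
  ...   | inj₁ (atLeast f f-inj lost) = inj₂ λ _ →
            lost⇒single-row lat i j (v ∘ f) v-inj (λ a → _ , _ , refl) lost md ,
            flipped (lost⇒single-row (transpose-latin lat) j i (v ∘ f) v-inj (λ a → _ , _ , refl)
              (λ a i′ j′ e → swap⊎ (lost a j′ i′ e)) md)
    where
    v-inj : Inj (v ∘ f)
    v-inj a b e = f-inj a b (c-inj _ _ e)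
    flipped : AtLeast d (Single {L = transpose L} j) → AtLeast d (λ i′ → Single {L = L} i′ j)
    flipped (atLeast g g-inj h) = atLeast g g-inj λ a i′ j′ e → swap× (h a j′ i′ e)

-- The threshold and the induction on the order.

threshold : ℕ → ℕ
threshold n = (3 * (n * n)) / 4

half-parity : ∀ n → ⌈ n /2⌉ ≡ ⌊ n /2⌋ ⊎ ⌈ n /2⌉ ≡ suc ⌊ n /2⌋
half-parity zero = inj₁ refl
half-parity (suc zero) = inj₂ refl
half-parity (suc (suc n)) = map⊎ (cong suc) (cong suc) (half-parity n)

[r+q*4]/4≡q : ∀ r q → r < 4 → (r + q * 4) / 4 ≡ q
[r+q*4]/4≡q r q r<4 = trans (+-distrib-/-∣ʳ r (n∣m*n q)) (cong₂ _+_ (m<n⇒m/n≡0 r<4) (m*n/n≡m q 4))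

-- `3n²` is `12a²` for `n = 2a` and `12a(a + 1) + 3` for `n = 2a + 1`, and the remainder 3 is
-- dropped by the division.
threshold-half : ∀ n → threshold n ≡ 3 * (⌊ n /2⌋ * ⌈ n /2⌉)
threshold-half n = trans (cong threshold (sym (⌊n/2⌋+⌈n/2⌉≡n n))) (by-parity ⌊ n /2⌋ ⌈ n /2⌉ (half-parity n))
  where
  even : ∀ a → 3 * ((a + a) * (a + a)) ≡ 0 + (3 * (a * a)) * 4
  even = solve-∀
  odd : ∀ a → 3 * ((a + suc a) * (a + suc a)) ≡ 3 + (3 * (a * suc a)) * 4
  odd = solve-∀
  by-parity : ∀ a b → b ≡ a ⊎ b ≡ suc a → threshold (a + b) ≡ 3 * (a * b)
  by-parity a b (inj₁ refl) = trans (cong (_/ 4) (even a)) ([r+q*4]/4≡q 0 (3 * (a * a)) (s≤s z≤n))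
  by-parity a b (inj₂ refl) = trans (cong (_/ 4) (odd a)) ([r+q*4]/4≡q 3 (3 * (a * suc a)) ≤-refl)

-- The halves `⌊ m /2⌋` and `⌈ m /2⌉` become `⌈ m /2⌉` and `1 + ⌊ m /2⌋`. The increment is the
-- number of symbols that one deletion may lose.
threshold-suc : ∀ m → threshold (suc m) ≡ 3 * ⌈ m /2⌉ + threshold m
threshold-suc m rewrite threshold-half m | threshold-half (suc m) = step ⌊ m /2⌋ ⌈ m /2⌉
  where
  step : ∀ a b → 3 * (b * suc a) ≡ 3 * b + 3 * (a * b)
  step = solve-∀

-- The remainder modulo 4 is at most 3, the source of the `+ 3` in the earlier bounds.
threshold-≥ : ∀ n → 3 * (n * n) ≤ 4 * threshold n + 3
threshold-≥ n = begin
  3 * (n * n)                                ≡⟨ m≡m%n+[m/n]*n (3 * (n * n)) 4 ⟩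
  (3 * (n * n)) % 4 + threshold n * 4        ≤⟨ +-monoˡ-≤ (threshold n * 4) (≤-pred (m%n<n (3 * (n * n)) 4)) ⟩
  3 + threshold n * 4                        ≡⟨ comm (threshold n) ⟩
  4 * threshold n + 3                        ∎
  where
  open ≤-Reasoning
  comm : ∀ x → 3 + x * 4 ≡ 4 * x + 3
  comm = solve-∀

transversal-exists : ∀ n (L : Square n) → IsGenLatin n L → HasAtLeastSymbols n L (threshold n) → HasTransversal n L
transversal-exists zero L _ _ = (λ ()) , (λ { {()} }) , (λ ())
transversal-exists (suc zero) L _ _ = id , id , λ { zero zero _ → refl }
transversal-exists (suc (suc m)) L lat syms
  -- Losing `3 * h` symbols is affordable by `threshold-suc`. Of `3 * h + 1` lost symbols at most
  -- `m + 1 ≤ 2 * h` meet the column outside the row, so `h + 1` are single in the row, more than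
  -- half of the order `m + 2`.
  with minor-or-rich {s = threshold (suc m)} {x = suc (3 * h)} {d = suc h} lat syms
         (λ i j → transversal-exists (suc m) (minor L i j) (minor-latin i j lat))
         (s≤s (≤-reflexive (sym (threshold-suc (suc m)))))
         (s≤s (subst₂ _≤_ (sym (+-suc (suc m) h)) (cong suc (triple h)) (s≤s (+-monoˡ-≤ h (n≤⌈n/2⌉+⌈n/2⌉ (suc m))))))
  where
  h : ℕ
  h = ⌈ suc m /2⌉
  triple : ∀ x → x + x + x ≡ 3 * x
  triple = solve-∀
... | inj₁ t = t
... | inj₂ rich = rich-transversal lat syms (threshold-≥ (suc (suc m))) (s≤s (s≤s z≤n)) rich
  (s≤s (subst (suc (suc m) ≤_) (sym (+-suc ⌈ suc m /2⌉ ⌈ suc m /2⌉)) (s≤s (n≤⌈n/2⌉+⌈n/2⌉ (suc m)))))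

theorem1 : (n : ℕ) → 1 < n → (L : Square n) → IsGenLatin n L →
    HasAtLeastSymbols n L ((3 * (n * n)) / 4) → HasTransversal n L
theorem1 n _ = transversal-exists n
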